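{- Assume set replacement. Let \(\mathcal V\) be a univalent universe. Then the ordinal \(\mathrm{Ord}_{\mathcal V}\) of ordinals in \(\mathcal V\) has suprema of families indexed by types in \(\mathcal V\): for every \(I:\mathcal V\) and \(\alpha:I\to\mathrm{Ord}_{\mathcal V}\) there is \(\hat\alpha:\mathrm{Ord}_{\mathcal V}\) with \(\alpha_i\preceq\hat\alpha\) for all \(i\), and \(\hat\alpha\preceq\beta\) for every \(\beta:\mathrm{Ord}_{\mathcal V}\) with \(\alpha_i\preceq\beta\) for all \(i:I\).
   Context: Work in univalent foundations (intensional Martin-Löf type theory with universes, function and propositional extensionality, propositional truncations in each universe). An ordinal is a type with a proposition-valued, transitive, extensional and (inductively) well-founded relation \(\prec\). \(\mathrm{Ord}_{\mathcal V}\) is the type of ordinals whose carrier is in \(\mathcal V\). For \(y:\beta\), \(\beta\downarrow y\) is the ordinal of elements \(b\prec y\). A simulation \(f:\alpha\to\beta\) is a map preserving \(\prec\) such that whenever \(y\prec f(x)\) there is \(x'\prec x\) with \(f(x')=y\). Write \(\alpha\preceq\beta\) if there is a simulation \(\alpha\to\beta\). Set replacement: for all universes \(\mathcal U,\mathcal V\), the image \(\Sigma_{y:Y}\exists_{x:X}(f(x)=y)\) of any map \(f:X\to Y\) with \(X\) equivalent to a type in \(\mathcal U\) and \(Y\) a set whose identity types are equivalent to types in \(\mathcal V\) is equivalent to a type in \(\mathcal U\sqcup\mathcal V\). -}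

{-# OPTIONS --without-K #-}
module Defs where

open import Level using (Level; _⊔_; suc; Setω)
open import Data.Product using (Σ; Σ-syntax; _×_; _,_; proj₁; proj₂)
open import Relation.Binary.PropositionalEquality using (_≡_; refl)
open import Induction.WellFounded using (WellFounded)
open import Axiom.Extensionality.Propositional using (Extensionality)

private variable a b ℓ : Level

isProp : Set a → Set a
isProp A = (x y : A) → x ≡ y

isSet : Set a → Set a
isSet A = (x y : A) → isProp (x ≡ y)

isContr : Set a → Set a
isContr A = Σ[ c ∈ A ] ((x : A) → c ≡ x)

fiber : {A : Set a} {B : Set b} → (A → B) → B → Set (a ⊔ b)
fiber {A = A} f y = Σ[ x ∈ A ] (f x ≡ y)

isEquiv : {A : Set a} {B : Set b} → (A → B) → Set (a ⊔ b)
isEquiv {B = B} f = (y : B) → isContr (fiber f y)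

_≃_ : Set a → Set b → Set (a ⊔ b)
A ≃ B = Σ[ f ∈ (A → B) ] isEquiv f

idEquiv : (A : Set a) → A ≃ A
idEquiv A = (λ x → x) , λ y → (y , refl) , λ { (x , refl) → refl }

idtoeqv : {A B : Set a} → A ≡ B → A ≃ B
idtoeqv {A = A} refl = idEquiv A

FunExt : Setω
FunExt = ∀ {a b} → Extensionality a b

PropExt : Setω
PropExt = ∀ {ℓ} {P Q : Set ℓ} → isProp P → isProp Q → (P → Q) → (Q → P) → P ≡ Q

record PropTrunc : Setω where
  field
    ∥_∥       : {ℓ : Level} → Set ℓ → Set ℓ
    ∥∥-isProp : {ℓ : Level} {A : Set ℓ} → isProp ∥ A ∥
    ∣_∣       : {ℓ : Level} {A : Set ℓ} → A → ∥ A ∥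
    ∥∥-rec    : {ℓ ℓ' : Level} {A : Set ℓ} {P : Set ℓ'} →
                isProp P → (A → P) → ∥ A ∥ → P

isUnivalent : (v : Level) → Set (suc v)
isUnivalent v = (A B : Set v) → isEquiv (idtoeqv {A = A} {B = B})

module _ (pt : PropTrunc) where
  open PropTrunc pt

  image : {X : Set a} {Y : Set b} → (X → Y) → Set (a ⊔ b)
  image {X = X} {Y = Y} f = Σ[ y ∈ Y ] ∥ Σ[ x ∈ X ] (f x ≡ y) ∥

  SetReplacement : Setω
  SetReplacement =
    ∀ {𝓤 𝓥 a b} {X : Set a} {Y : Set b} (f : X → Y) →
    Σ[ X' ∈ Set 𝓤 ] (X ≃ X') →
    isSet Y →
    ((y y' : Y) → Σ[ T ∈ Set 𝓥 ] ((y ≡ y') ≃ T)) →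
    Σ[ Z ∈ Set (𝓤 ⊔ 𝓥) ] (image f ≃ Z)

record Ordinal (v : Level) : Set (suc v) where
  field
    ⟨_⟩   : Set v
    _≺_   : ⟨_⟩ → ⟨_⟩ → Set v
    ≺-prop  : (x y : ⟨_⟩) → isProp (x ≺ y)
    ≺-trans : (x y z : ⟨_⟩) → x ≺ y → y ≺ z → x ≺ z
    ≺-ext   : (x y : ⟨_⟩) → ((u : ⟨_⟩) → (u ≺ x → u ≺ y) × (u ≺ y → u ≺ x)) → x ≡ y
    ≺-wf    : WellFounded _≺_

open Ordinal public

_↓_ : {v : Level} (β : Ordinal v) → ⟨ β ⟩ → Set v
β ↓ y = Σ[ b ∈ ⟨ β ⟩ ] (_≺_ β b y)

isSimulation : {v w : Level} (α : Ordinal v) (β : Ordinal w) → (⟨ α ⟩ → ⟨ β ⟩) → Set (v ⊔ w)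
isSimulation α β f =
  ((x x' : ⟨ α ⟩) → _≺_ α x' x → _≺_ β (f x') (f x)) ×
  ((x : ⟨ α ⟩) (y : ⟨ β ⟩) → _≺_ β y (f x) →
     Σ[ x' ∈ ⟨ α ⟩ ] (_≺_ α x' x × (f x' ≡ y)))

_⪯_ : {v w : Level} → Ordinal v → Ordinal w → Set (v ⊔ w)
α ⪯ β = Σ[ f ∈ (⟨ α ⟩ → ⟨ β ⟩) ] isSimulation α β f

{-# OPTIONS --safe --without-K #-}
module Submission where

-- The supremum is a quotient of the disjoint union X = Σ i, ⟨ α i ⟩: two points are identified
-- when their initial segments are isomorphic, and x lies below (j , c) when x is identified
-- with a point below c. This quotient is small by set replacement: it is the image of
-- x ↦ (λ y → y ≈ x) in the set of predicates X → Ω, whose equality is settled by function and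
-- propositional extensionality. Each α i maps into the quotient
-- through its points; conversely, simulations α i ⪯ β induce a well-defined map out of it,
-- because a simulation carries initial segments to isomorphic ones and a point of β is
-- determined by its initial segment.

open import Defs
open import Level using (Level; _⊔_) renaming (suc to lsuc)
open import Data.Product using (Σ; Σ-syntax; _×_; _,_; proj₁; proj₂)
open import Data.Unit.Polymorphic using (⊤)
open import Function using (_∘_; id; _on_)
open import Relation.Binary.PropositionalEquality
  using (_≡_; refl; sym; trans; cong; cong₂; subst; subst₂)
open import Induction.WellFounded using (WellFounded; Acc; acc)
import Relation.Binary.Construct.On as On
open import Axiom.Extensionality.Propositional using (implicit-extensionality)
open import Axiom.UniquenessOfIdentityProofs using (module Constant⇒UIP)

private variable
  a b u v w : Level

isSet-fromPropRelation : {A : Set a} (R : A → A → Set b) → (∀ x y → isProp (R x y)) →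
                         (∀ x → R x x) → (∀ {x y} → R x y → x ≡ y) → isSet A
isSet-fromPropRelation R R-isProp R-refl R⇒≡ x y = ≡-irrelevant
  where
  open Constant⇒UIP (λ {x} x≡y → R⇒≡ (subst (R x) x≡y (R-refl x)))
                    (λ {x} {y} _ _ → cong R⇒≡ (R-isProp x y _ _))

isSet-injective : {A : Set a} {B : Set b} (f : A → B) →
                  (∀ {x y} → f x ≡ f y → x ≡ y) → isSet B → isSet A
isSet-injective f f-injective B-isSet =
  isSet-fromPropRelation (λ x y → f x ≡ f y) (λ x y → B-isSet (f x) (f y)) (λ _ → refl) f-injective

isProp→isSet : {A : Set a} → isProp A → isSet A
isProp→isSet {a} A-isProp =
  isSet-fromPropRelation (λ _ _ → ⊤ {a}) (λ _ _ _ _ → refl) _ (λ _ → A-isProp _ _)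

isProp× : {A : Set a} {B : Set b} → isProp A → isProp B → isProp (A × B)
isProp× A-isProp B-isProp (x , y) (x' , y') = cong₂ _,_ (A-isProp x x') (B-isProp y y')

Σ≡Prop : {A : Set a} {B : A → Set b} → (∀ x → isProp (B x)) →
         {p q : Σ A B} → proj₁ p ≡ proj₁ q → p ≡ q
Σ≡Prop B-isProp {x , y} {.x , y'} refl = cong (x ,_) (B-isProp x y y')

propEquiv : {A : Set a} {B : Set b} → isProp A → isProp B → (A → B) → (B → A) → A ≃ B
propEquiv A-isProp B-isProp f g =
  f , λ y → (g y , B-isProp _ _) ,
            λ _ → Σ≡Prop (λ x → isProp→isSet B-isProp (f x) y) (A-isProp _ _)

module Equivalence {A : Set a} {B : Set b} (e : A ≃ B) where

  to : A → B
  to = proj₁ e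

  from : B → A
  from y = proj₁ (proj₁ (proj₂ e y))

  to-from : ∀ y → to (from y) ≡ y
  to-from y = proj₂ (proj₁ (proj₂ e y))

  from-to : ∀ x → from (to x) ≡ x
  from-to x = cong proj₁ (proj₂ (proj₂ e (to x)) (x , refl))

≺-syntax : (A : Ordinal u) → ⟨ A ⟩ → ⟨ A ⟩ → Set u
≺-syntax = _≺_

syntax ≺-syntax A x y = x ≺⟨ A ⟩ y

infix 25 _↓ₒ_

_↓ₒ_ : (A : Ordinal u) → ⟨ A ⟩ → Ordinal u
A ↓ₒ a = record
  { ⟨_⟩     = A ↓ a
  ; _≺_     = _≺_ A on proj₁
  ; ≺-prop  = λ x y → ≺-prop A (proj₁ x) (proj₁ y)
  ; ≺-trans = λ x y z → ≺-trans A (proj₁ x) (proj₁ y) (proj₁ z)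
  ; ≺-ext   = λ x y same → Σ≡Prop (λ b → ≺-prop A b a) (≺-ext A (proj₁ x) (proj₁ y) λ b →
                (λ b≺x → proj₁ (same (b , ≺-trans A b (proj₁ x) a b≺x (proj₂ x))) b≺x) ,
                (λ b≺y → proj₂ (same (b , ≺-trans A b (proj₁ y) a b≺y (proj₂ y))) b≺y))
  ; ≺-wf    = On.wellFounded proj₁ (≺-wf A)
  }

⪯-refl : (A : Ordinal u) → A ⪯ A
⪯-refl A = id , (λ _ _ → id) , (λ _ y y≺x → y , y≺x , refl)

⪯-trans : (A : Ordinal u) (B : Ordinal v) (C : Ordinal w) → A ⪯ B → B ⪯ C → A ⪯ C
⪯-trans A B C (f , f-mono , f-lift) (g , g-mono , g-lift) =
  g ∘ f ,
  (λ x x' x'≺x → g-mono (f x) (f x') (f-mono x x' x'≺x)) ,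
  λ x z z≺gfx →
    let (y , y≺fx , gy≡z) = g-lift (f x) z z≺gfx
        (x' , x'≺x , fx'≡y) = f-lift x y y≺fx
    in x' , x'≺x , trans (cong g fx'≡y) gy≡z

↓-inclusion : (A : Ordinal u) (a : ⟨ A ⟩) → A ↓ₒ a ⪯ A
↓-inclusion A a =
  proj₁ , (λ _ _ → id) ,
  λ (b , b≺a) c c≺b → (c , ≺-trans A c b a c≺b b≺a) , c≺b , refl

⪯-restrict : (A : Ordinal u) (B : Ordinal v) ((f , _) : A ⪯ B) (a : ⟨ A ⟩) → A ↓ₒ a ⪯ B ↓ₒ f a
⪯-restrict A B (f , f-mono , f-lift) a =
  (λ (x , x≺a) → f x , f-mono a x x≺a) ,
  (λ x x' → f-mono (proj₁ x) (proj₁ x')) ,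
  λ (x , x≺a) (y , y≺fa) y≺fx →
    let (x' , x'≺x , fx'≡y) = f-lift x y y≺fx
    in (x' , ≺-trans A x' x a x'≺x x≺a) , x'≺x , Σ≡Prop (λ b → ≺-prop B b (f a)) fx'≡y

module _ (A : Ordinal u) (B : Ordinal v) where

  ⪯-below : ((f , _) (g , _) : A ⪯ B) {x : ⟨ A ⟩} → (∀ {x'} → x' ≺⟨ A ⟩ x → f x' ≡ g x') →
            ∀ y → y ≺⟨ B ⟩ f x → y ≺⟨ B ⟩ g x
  ⪯-below (f , f-mono , f-lift) (g , g-mono , g-lift) {x} agree y y≺fx =
    let (x' , x'≺x , fx'≡y) = f-lift x y y≺fx
    in subst (λ z → z ≺⟨ B ⟩ g x) (trans (sym (agree x'≺x)) fx'≡y) (g-mono x x' x'≺x)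

  ⪯-unique : ((f , _) (g , _) : A ⪯ B) → ∀ x → f x ≡ g x
  ⪯-unique s t x = go (≺-wf A x)
    where
    go : ∀ {x} → Acc (_≺_ A) x → proj₁ s x ≡ proj₁ t x
    go (acc rs) = ≺-ext B _ _ λ y →
      ⪯-below s t (go ∘ rs) y , ⪯-below t s (sym ∘ go ∘ rs) y

record _≋_ (A : Ordinal u) (B : Ordinal v) : Set (u ⊔ v) where
  constructor _,≋_
  field
    ≋⇒⪯ : A ⪯ B
    ≋⇒⪰ : B ⪯ A

open _≋_

≋-refl : {A : Ordinal u} → A ≋ A
≋-refl {A = A} = ⪯-refl A ,≋ ⪯-refl A

≋-sym : {A : Ordinal u} {B : Ordinal v} → A ≋ B → B ≋ A
≋-sym (s ,≋ t) = t ,≋ s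

≋-trans : {A : Ordinal u} {B : Ordinal v} {C : Ordinal w} → A ≋ B → B ≋ C → A ≋ C
≋-trans {A = A} {B} {C} (s ,≋ t) (s' ,≋ t') = ⪯-trans A B C s s' ,≋ ⪯-trans C B A t' t

module _ (fe : FunExt) (pt : PropTrunc) where
  open PropTrunc pt

  ∥∥-map : {A : Set a} {B : Set b} → (A → B) → ∥ A ∥ → ∥ B ∥
  ∥∥-map f = ∥∥-rec ∥∥-isProp (∣_∣ ∘ f)

  isPropΠ : {A : Set a} {B : A → Set b} → (∀ x → isProp (B x)) → isProp ((x : A) → B x)
  isPropΠ B-isProp f g = fe λ x → B-isProp x (f x) (g x)

  isPropIsProp : {A : Set a} → isProp (isProp A)
  isPropIsProp p q = fe λ x → fe λ y → isProp→isSet p x y (p x y) (q x y)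

  isPropAcc : {A : Set a} {_<_ : A → A → Set b} {x : A} → isProp (Acc _<_ x)
  isPropAcc (acc rs) (acc ss) =
    cong acc (implicit-extensionality fe (fe λ y<x → isPropAcc (rs y<x) (ss y<x)))

  ⟨⟩-isSet : (A : Ordinal u) → isSet ⟨ A ⟩
  ⟨⟩-isSet A = isSet-fromPropRelation sameLower sameLower-isProp (λ _ _ → id , id) (≺-ext A _ _)
    where
    sameLower : ⟨ A ⟩ → ⟨ A ⟩ → Set _
    sameLower x y = ∀ z → (z ≺⟨ A ⟩ x → z ≺⟨ A ⟩ y) × (z ≺⟨ A ⟩ y → z ≺⟨ A ⟩ x)
    sameLower-isProp : ∀ x y → isProp (sameLower x y)
    sameLower-isProp x y = isPropΠ λ z →
      isProp× (isPropΠ λ _ → ≺-prop A z y) (isPropΠ λ _ → ≺-prop A z x)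

  module _ (A : Ordinal u) (B : Ordinal v) where

    isTruncatedSimulation : (⟨ A ⟩ → ⟨ B ⟩) → Set (u ⊔ v)
    isTruncatedSimulation f =
      ((x x' : ⟨ A ⟩) → x' ≺⟨ A ⟩ x → f x' ≺⟨ B ⟩ f x) ×
      ((x : ⟨ A ⟩) (y : ⟨ B ⟩) → y ≺⟨ B ⟩ f x → ∥ Σ[ x' ∈ ⟨ A ⟩ ] (x' ≺⟨ A ⟩ x × (f x' ≡ y)) ∥)

    truncatedSimulation-injective : {f : ⟨ A ⟩ → ⟨ B ⟩} → isTruncatedSimulation f →
                                    ∀ {x y} → f x ≡ f y → x ≡ y
    truncatedSimulation-injective {f} (f-mono , f-lift) {x} = go (≺-wf A x)
      where
      go : ∀ {x} → Acc (_≺_ A) x → ∀ {y} → f x ≡ f y → x ≡ y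
      go {x} (acc rs) {y} fx≡fy = ≺-ext A x y λ z → below-y z , below-x z
        where
        below-y : ∀ z → z ≺⟨ A ⟩ x → z ≺⟨ A ⟩ y
        below-y z z≺x =
          ∥∥-rec (≺-prop A z y)
            (λ (z' , z'≺y , fz'≡fz) →
               subst (λ t → t ≺⟨ A ⟩ y) (sym (go (rs z≺x) (sym fz'≡fz))) z'≺y)
            (f-lift y (f z) (subst (λ t → f z ≺⟨ B ⟩ t) fx≡fy (f-mono x z z≺x)))
        below-x : ∀ z → z ≺⟨ A ⟩ y → z ≺⟨ A ⟩ x
        below-x z z≺y =
          ∥∥-rec (≺-prop A z x)
            (λ (z' , z'≺x , fz'≡fz) → subst (λ t → t ≺⟨ A ⟩ x) (go (rs z'≺x) fz'≡fz) z'≺x)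
            (f-lift x (f z) (subst (λ t → f z ≺⟨ B ⟩ t) (sym fx≡fy) (f-mono y z z≺y)))

    lifts-isProp : {f : ⟨ A ⟩ → ⟨ B ⟩} → (∀ {x y} → f x ≡ f y → x ≡ y) →
                   ∀ x y → isProp (Σ[ x' ∈ ⟨ A ⟩ ] (x' ≺⟨ A ⟩ x × (f x' ≡ y)))
    lifts-isProp {f} f-injective x y (x₁ , _ , fx₁≡y) (x₂ , _ , fx₂≡y) =
      Σ≡Prop (λ x' → isProp× (≺-prop A x' x) (⟨⟩-isSet B (f x') y))
             (f-injective (trans fx₁≡y (sym fx₂≡y)))

    truncatedSimulation⇒⪯ : {f : ⟨ A ⟩ → ⟨ B ⟩} → isTruncatedSimulation f → A ⪯ B
    truncatedSimulation⇒⪯ {f} f-sim@(f-mono , f-lift) =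
      f , f-mono , λ x y y≺fx →
        ∥∥-rec (lifts-isProp (truncatedSimulation-injective f-sim) x y) id (f-lift x y y≺fx)

    ⪯-injective : ((f , _) : A ⪯ B) → ∀ {x y} → f x ≡ f y → x ≡ y
    ⪯-injective (f , f-mono , f-lift) =
      truncatedSimulation-injective (f-mono , λ x y y≺fx → ∣ f-lift x y y≺fx ∣)

    isProp⪯ : isProp (A ⪯ B)
    isProp⪯ s t = Σ≡Prop isSimulation-isProp (fe (⪯-unique A B s t))
      where
      isSimulation-isProp : ∀ f → isProp (isSimulation A B f)
      isSimulation-isProp f f-sim = isProp×
        (isPropΠ λ x → isPropΠ λ x' → isPropΠ λ _ → ≺-prop B (f x') (f x))
        (isPropΠ λ x → isPropΠ λ y → isPropΠ λ _ → lifts-isProp (⪯-injective (f , f-sim)) x y)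
        f-sim

    ⪯-reflects : ((f , _) : A ⪯ B) → ∀ {x x'} → f x' ≺⟨ B ⟩ f x → x' ≺⟨ A ⟩ x
    ⪯-reflects s@(f , _ , f-lift) {x} {x'} fx'≺fx =
      let (x'' , x''≺x , fx''≡fx') = f-lift x (f x') fx'≺fx
      in subst (λ t → t ≺⟨ A ⟩ x) (⪯-injective s fx''≡fx') x''≺x

    ⪯-corestrict : ((f , _) : A ⪯ B) (a : ⟨ A ⟩) → B ↓ₒ f a ⪯ A ↓ₒ a
    ⪯-corestrict s@(f , f-mono , f-lift) a = g , g-mono , g-lift
      where
      g : B ↓ f a → A ↓ a
      g (y , y≺fa) = let (x , x≺a , _) = f-lift a y y≺fa in x , x≺a
      f∘g : ∀ y → f (proj₁ (g y)) ≡ proj₁ y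
      f∘g (y , y≺fa) = proj₂ (proj₂ (f-lift a y y≺fa))
      g-mono : ∀ y y' → proj₁ y' ≺⟨ B ⟩ proj₁ y → proj₁ (g y') ≺⟨ A ⟩ proj₁ (g y)
      g-mono y y' y'≺y = ⪯-reflects s (subst₂ (_≺_ B) (sym (f∘g y')) (sym (f∘g y)) y'≺y)
      g-lift : ∀ y x → proj₁ x ≺⟨ A ⟩ proj₁ (g y) →
               Σ[ y' ∈ B ↓ f a ] (proj₁ y' ≺⟨ B ⟩ proj₁ y × (g y' ≡ x))
      g-lift y (x , x≺a) x≺gy =
        (f x , f-mono a x x≺a) ,
        subst (λ t → f x ≺⟨ B ⟩ t) (f∘g y) (f-mono _ x x≺gy) ,
        Σ≡Prop (λ x' → ≺-prop A x' a) (⪯-injective s (f∘g (f x , f-mono a x x≺a)))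

    ⪯-↓-≋ : ((f , _) : A ⪯ B) (a : ⟨ A ⟩) → A ↓ₒ a ≋ B ↓ₒ f a
    ⪯-↓-≋ s a = ⪯-restrict A B s a ,≋ ⪯-corestrict s a

  isProp≋ : {A : Ordinal u} {B : Ordinal v} → isProp (A ≋ B)
  isProp≋ {A = A} {B} (s ,≋ t) (s' ,≋ t') = cong₂ _,≋_ (isProp⪯ A B s s') (isProp⪯ B A t t')

  ↓↓-≋ : (A : Ordinal u) (a : ⟨ A ⟩) (b : A ↓ a) → (A ↓ₒ a) ↓ₒ b ≋ A ↓ₒ proj₁ b
  ↓↓-≋ A a = ⪯-↓-≋ (A ↓ₒ a) A (↓-inclusion A a)

  ↓-⪯-↓-≋ : (A : Ordinal u) (B : Ordinal v) {a : ⟨ A ⟩} {b : ⟨ B ⟩} ((f , _) : A ↓ₒ a ⪯ B ↓ₒ b)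
            (x : A ↓ a) → A ↓ₒ proj₁ x ≋ B ↓ₒ proj₁ (f x)
  ↓-⪯-↓-≋ A B {a} {b} s x =
    ≋-trans (≋-sym (↓↓-≋ A a x)) (≋-trans (⪯-↓-≋ (A ↓ₒ a) (B ↓ₒ b) s x) (↓↓-≋ B b (proj₁ s x)))

  ↓-injective : (A : Ordinal u) {a a' : ⟨ A ⟩} → A ↓ₒ a ≋ A ↓ₒ a' → a ≡ a'
  ↓-injective A {a} {a'} (s ,≋ t) = ≺-ext A a a' λ b → ↓-⪯⇒≺ s b , ↓-⪯⇒≺ t b
    where
    ↓-⪯⇒≺ : ∀ {c c'} → A ↓ₒ c ⪯ A ↓ₒ c' → ∀ b → b ≺⟨ A ⟩ c → b ≺⟨ A ⟩ c'
    ↓-⪯⇒≺ {c} {c'} s b b≺c =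
      subst (λ t → t ≺⟨ A ⟩ c')
        (⪯-unique (A ↓ₒ c) A (⪯-trans (A ↓ₒ c) (A ↓ₒ c') A s (↓-inclusion A c'))
                  (↓-inclusion A c) (b , b≺c))
        (proj₂ (proj₁ s (b , b≺c)))

  ⪯-fromSegments : (A : Ordinal u) (B : Ordinal v) →
                   (∀ a → ∥ Σ[ b ∈ ⟨ B ⟩ ] (A ↓ₒ a ≋ B ↓ₒ b) ∥) → A ⪯ B
  ⪯-fromSegments A B segment = f , f-mono , f-lift
    where
    uniqueSegment : ∀ a → isProp (Σ[ b ∈ ⟨ B ⟩ ] (A ↓ₒ a ≋ B ↓ₒ b))
    uniqueSegment a (b , e) (b' , e') =
      Σ≡Prop (λ _ → isProp≋) (↓-injective B (≋-trans (≋-sym e) e'))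
    f : ⟨ A ⟩ → ⟨ B ⟩
    f a = proj₁ (∥∥-rec (uniqueSegment a) id (segment a))
    f-segment : ∀ a → A ↓ₒ a ≋ B ↓ₒ f a
    f-segment a = proj₂ (∥∥-rec (uniqueSegment a) id (segment a))
    f-mono : ∀ a a' → a' ≺⟨ A ⟩ a → f a' ≺⟨ B ⟩ f a
    f-mono a a' a'≺a =
      let s = ≋⇒⪯ (f-segment a)
      in subst (λ t → t ≺⟨ B ⟩ f a)
           (↓-injective B (≋-trans (≋-sym (↓-⪯-↓-≋ A B s (a' , a'≺a))) (f-segment a')))
           (proj₂ (proj₁ s (a' , a'≺a)))
    f-lift : ∀ a b → b ≺⟨ B ⟩ f a → Σ[ a' ∈ ⟨ A ⟩ ] (a' ≺⟨ A ⟩ a × (f a' ≡ b))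
    f-lift a b b≺fa =
      let t = ≋⇒⪰ (f-segment a)
          (a' , a'≺a) = proj₁ t (b , b≺fa)
      in a' , a'≺a ,
         ↓-injective B (≋-trans (≋-sym (f-segment a')) (≋-sym (↓-⪯-↓-≋ B A t (b , b≺fa))))

  module SmallQuotient (pe : PropExt) (sr : SetReplacement pt) {X : Set v}
    (_≈_ : X → X → Set v) (≈-isProp : ∀ x y → isProp (x ≈ y))
    (≈-refl : ∀ {x} → x ≈ x) (≈-sym : ∀ {x y} → x ≈ y → y ≈ x)
    (≈-trans : ∀ {x y z} → x ≈ y → y ≈ z → x ≈ z) where

    private
      Ω : Set (lsuc v)
      Ω = Σ (Set v) isProp

      _∼_ : (X → Ω) → (X → Ω) → Set v
      P ∼ Q = ∀ x → (proj₁ (P x) → proj₁ (Q x)) × (proj₁ (Q x) → proj₁ (P x))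

      ∼-isProp : ∀ P Q → isProp (P ∼ Q)
      ∼-isProp P Q = isPropΠ λ x →
        isProp× (isPropΠ λ _ → proj₂ (Q x)) (isPropΠ λ _ → proj₂ (P x))

      ∼-refl : ∀ P → P ∼ P
      ∼-refl P x = id , id

      ∼⇒≡ : ∀ {P Q} → P ∼ Q → P ≡ Q
      ∼⇒≡ {P} {Q} P∼Q = fe λ x → Σ≡Prop (λ _ → isPropIsProp)
        (pe (proj₂ (P x)) (proj₂ (Q x)) (proj₁ (P∼Q x)) (proj₂ (P∼Q x)))

      predicates-isSet : isSet (X → Ω)
      predicates-isSet = isSet-fromPropRelation _∼_ ∼-isProp ∼-refl ∼⇒≡

      class : X → X → Ω
      class x y = (y ≈ x) , ≈-isProp y x

      small : Σ[ Z ∈ Set v ] (image pt class ≃ Z)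
      small = sr class (X , idEquiv X) predicates-isSet λ P Q →
        P ∼ Q , propEquiv (predicates-isSet P Q) (∼-isProp P Q) (λ { refl → ∼-refl P }) ∼⇒≡

      open Equivalence (proj₂ small)

    X/≈ : Set v
    X/≈ = proj₁ small

    [_] : X → X/≈
    [ x ] = to (class x , ∣ x , refl ∣)

    []-sound : ∀ {x y} → x ≈ y → [ x ] ≡ [ y ]
    []-sound x≈y = cong to (Σ≡Prop (λ _ → ∥∥-isProp) (∼⇒≡ λ z →
      (λ z≈x → ≈-trans z≈x x≈y) , (λ z≈y → ≈-trans z≈y (≈-sym x≈y))))

    []-effective : ∀ {x y} → [ x ] ≡ [ y ] → x ≈ y
    []-effective {x} {y} [x]≡[y] = subst (λ P → proj₁ (P x)) (cong proj₁ classes-equal) ≈-refl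
      where
      classes-equal : (class x , ∣ x , refl ∣) ≡ (class y , ∣ y , refl ∣)
      classes-equal = trans (sym (from-to _)) (trans (cong from [x]≡[y]) (from-to _))

    []-surjective : ∀ z → ∥ Σ[ x ∈ X ] ([ x ] ≡ z) ∥
    []-surjective z = ∥∥-map
      (λ (x , class-x≡P) → x , trans (cong to (Σ≡Prop (λ _ → ∥∥-isProp) class-x≡P)) (to-from z))
      (proj₂ (from z))

    X/≈-isSet : isSet X/≈
    X/≈-isSet = isSet-injective (proj₁ ∘ from) from-injective predicates-isSet
      where
      from-injective : ∀ {z z'} → proj₁ (from z) ≡ proj₁ (from z') → z ≡ z'
      from-injective {z} {z'} e =
        trans (sym (to-from z)) (trans (cong to (Σ≡Prop (λ _ → ∥∥-isProp) e)) (to-from z'))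

    elimProp : (P : X/≈ → Set w) → (∀ z → isProp (P z)) → (∀ x → P [ x ]) → ∀ z → P z
    elimProp P P-isProp P[] z =
      ∥∥-rec (P-isProp z) (λ (x , [x]≡z) → subst P [x]≡z (P[] x)) ([]-surjective z)

    elimProp₂ : (P : X/≈ → X/≈ → Set w) → (∀ z z' → isProp (P z z')) →
                (∀ x y → P [ x ] [ y ]) → ∀ z z' → P z z'
    elimProp₂ P P-isProp P[] z z' =
      elimProp (λ z → P z z') (λ z → P-isProp z z')
        (λ x → elimProp (P [ x ]) (P-isProp [ x ]) (P[] x) z') z

    elimProp₃ : (P : X/≈ → X/≈ → X/≈ → Set w) → (∀ z z' z'' → isProp (P z z' z'')) →
                (∀ x y y' → P [ x ] [ y ] [ y' ]) → ∀ z z' z'' → P z z' z''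
    elimProp₃ P P-isProp P[] z z' z'' =
      elimProp (λ z → P z z' z'') (λ z → P-isProp z z' z'')
        (λ x → elimProp₂ (P [ x ]) (P-isProp [ x ]) (P[] x) z' z'') z

    module _ {B : Set w} (B-isSet : isSet B) (f : X → B)
      (f-respects : ∀ {x y} → x ≈ y → f x ≡ f y) where

      private
        value : X/≈ → B → Set (v ⊔ w)
        value z b = ∥ Σ[ x ∈ X ] ([ x ] ≡ z × f x ≡ b) ∥

        value-unique : ∀ z → isProp (Σ B (value z))
        value-unique z (b , vb) (b' , vb') = Σ≡Prop (λ _ → ∥∥-isProp)
          (∥∥-rec (B-isSet b b') (λ (x , [x]≡z , fx≡b) → ∥∥-rec (B-isSet b b')
            (λ (x' , [x']≡z , fx'≡b') →
               trans (sym fx≡b)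
                 (trans (f-respects ([]-effective (trans [x]≡z (sym [x']≡z)))) fx'≡b'))
            vb') vb)

        value-exists : ∀ z → Σ B (value z)
        value-exists z = ∥∥-rec (value-unique z)
          (λ (x , [x]≡z) → f x , ∣ x , [x]≡z , refl ∣) ([]-surjective z)

      rec : X/≈ → B
      rec z = proj₁ (value-exists z)

      rec-β : ∀ x → rec [ x ] ≡ f x
      rec-β x = ∥∥-rec (B-isSet _ _)
        (λ (x' , [x']≡[x] , fx'≡rec) → trans (sym fx'≡rec) (f-respects ([]-effective [x']≡[x])))
        (proj₂ (value-exists [ x ]))

    module QuotientOrdinal
      (_<_ : X → X → Set v) (<-isProp : ∀ x y → isProp (x < y))
      (<-respects : ∀ {x x' y y'} → x ≈ x' → y ≈ y' → x < y → x' < y')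
      (<-trans : ∀ {x y z} → x < y → y < z → x < z) (<-wf : WellFounded _<_)
      (<-extensional : ∀ {x y} → (∀ z → (z < x → z < y) × (z < y → z < x)) → x ≈ y) where

      _⊏_ : X/≈ → X/≈ → Set v
      z ⊏ z' = ∥ Σ[ x ∈ X ] Σ[ y ∈ X ] ([ x ] ≡ z × [ y ] ≡ z' × x < y) ∥

      []-mono : ∀ {x y} → x < y → [ x ] ⊏ [ y ]
      []-mono {x} {y} x<y = ∣ x , y , refl , refl , x<y ∣

      []-reflects : ∀ {x y} → [ x ] ⊏ [ y ] → x < y
      []-reflects {x} {y} = ∥∥-rec (<-isProp x y) λ (x' , y' , [x']≡[x] , [y']≡[y] , x'<y') →
        <-respects ([]-effective [x']≡[x]) ([]-effective [y']≡[y]) x'<y'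

      ⊏-trans : ∀ z z' z'' → z ⊏ z' → z' ⊏ z'' → z ⊏ z''
      ⊏-trans = elimProp₃ _ (λ _ _ _ → isPropΠ λ _ → isPropΠ λ _ → ∥∥-isProp)
        λ _ _ _ x⊏y y⊏y' → []-mono (<-trans ([]-reflects x⊏y) ([]-reflects y⊏y'))

      ⊏-ext : ∀ z z' → (∀ t → (t ⊏ z → t ⊏ z') × (t ⊏ z' → t ⊏ z)) → z ≡ z'
      ⊏-ext = elimProp₂ _ (λ z z' → isPropΠ λ _ → X/≈-isSet z z') λ x y same →
        []-sound (<-extensional λ t →
          (λ t<x → []-reflects (proj₁ (same [ t ]) ([]-mono t<x))) ,
          (λ t<y → []-reflects (proj₂ (same [ t ]) ([]-mono t<y))))

      []-acc : ∀ {x} → Acc _<_ x → Acc _⊏_ [ x ]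
      []-acc {x} (acc rs) = acc λ {z} →
        elimProp (λ z → z ⊏ [ x ] → Acc _⊏_ z) (λ _ → isPropΠ λ _ → isPropAcc)
          (λ y y⊏x → []-acc (rs ([]-reflects y⊏x))) z

      X/≈ₒ : Ordinal v
      X/≈ₒ = record
        { ⟨_⟩     = X/≈
        ; _≺_     = _⊏_
        ; ≺-prop  = λ _ _ → ∥∥-isProp
        ; ≺-trans = ⊏-trans
        ; ≺-ext   = ⊏-ext
        ; ≺-wf    = elimProp (Acc _⊏_) (λ _ → isPropAcc) λ x → []-acc (<-wf x)
        }

      toQuotient-⪯ : (A : Ordinal u) (f : ⟨ A ⟩ → X) →
                     (∀ a a' → a' ≺⟨ A ⟩ a → f a' < f a) →
                     (∀ a x → x < f a → ∥ Σ[ a' ∈ ⟨ A ⟩ ] (a' ≺⟨ A ⟩ a × x ≈ f a') ∥) →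
                     A ⪯ X/≈ₒ
      toQuotient-⪯ A f f-mono f-lift = truncatedSimulation⇒⪯ A X/≈ₒ {[_] ∘ f}
        ( (λ a a' a'≺a → []-mono (f-mono a a' a'≺a))
        , λ a → elimProp _ (λ _ → isPropΠ λ _ → ∥∥-isProp) λ x x⊏fa →
            ∥∥-map (λ (a' , a'≺a , x≈fa') → a' , a'≺a , []-sound (≈-sym x≈fa'))
                   (f-lift a x ([]-reflects x⊏fa)))

      fromQuotient-⪯ : (B : Ordinal u) (g : X → ⟨ B ⟩) → (∀ {x y} → x ≈ y → g x ≡ g y) →
                       (∀ x y → y < x → g y ≺⟨ B ⟩ g x) →
                       (∀ x b → b ≺⟨ B ⟩ g x → ∥ Σ[ y ∈ X ] (y < x × g y ≡ b) ∥) →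
                       X/≈ₒ ⪯ B
      fromQuotient-⪯ B g g-respects g-mono g-lift = truncatedSimulation⇒⪯ X/≈ₒ B {G}
        ( elimProp₂ _ (λ _ _ → isPropΠ λ _ → ≺-prop B _ _)
            (λ x y y⊏x → subst₂ (_≺_ B) (sym (G-β y)) (sym (G-β x)) (g-mono x y ([]-reflects y⊏x)))
        , elimProp _ (λ _ → isPropΠ λ _ → isPropΠ λ _ → ∥∥-isProp) λ x b b≺Gx →
            ∥∥-map (λ (y , y<x , gy≡b) → [ y ] , []-mono y<x , trans (G-β y) gy≡b)
                   (g-lift x b (subst (λ t → b ≺⟨ B ⟩ t) (G-β x) b≺Gx)))
        where
        G : X/≈ → ⟨ B ⟩
        G = rec (⟨⟩-isSet B) g g-respects
        G-β : ∀ x → G [ x ] ≡ g x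
        G-β = rec-β (⟨⟩-isSet B) g g-respects

  module Supremum (pe : PropExt) (sr : SetReplacement pt) {I : Set v} (α : I → Ordinal v) where

    X : Set v
    X = Σ I (⟨_⟩ ∘ α)

    segment : X → Ordinal v
    segment (i , a) = α i ↓ₒ a

    _≈_ : X → X → Set v
    x ≈ y = segment x ≋ segment y

    _<_ : X → X → Set v
    x < (j , c) = ∥ Σ[ b ∈ ⟨ α j ⟩ ] (b ≺⟨ α j ⟩ c × x ≈ (j , b)) ∥

    <-respectsʳ : ∀ {x y y'} → y ≈ y' → x < y → x < y'
    <-respectsʳ {x} {j , c} {j' , c'} (s ,≋ _) = ∥∥-map λ (b , b≺c , x≈b) →
      let (b' , b'≺c') = proj₁ s (b , b≺c)
      in b' , b'≺c' , ≋-trans x≈b (↓-⪯-↓-≋ (α j) (α j') s (b , b≺c))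

    <-respects : ∀ {x x' y y'} → x ≈ x' → y ≈ y' → x < y → x' < y'
    <-respects {y = j , c} x≈x' y≈y' x<y =
      <-respectsʳ y≈y' (∥∥-map (λ (b , b≺c , x≈b) → b , b≺c , ≋-trans (≋-sym x≈x') x≈b) x<y)

    <-trans : ∀ {x y z} → x < y → y < z → x < z
    <-trans {z = k , c} x<y = ∥∥-rec ∥∥-isProp λ (c' , c'≺c , y≈c') →
      ∥∥-map (λ (b , b≺c' , x≈b) → b , ≺-trans (α k) b c' c b≺c' c'≺c , x≈b) (<-respectsʳ y≈c' x<y)

    ≈-acc : ∀ {x y} → x ≈ y → Acc _<_ y → Acc _<_ x
    ≈-acc {x} x≈y (acc rs) = acc λ {z} z<x → rs (<-respects {z} ≋-refl x≈y z<x)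

    <-wf : WellFounded _<_
    <-wf (i , a) = <-acc (≺-wf (α i) a)
      where
      <-acc : ∀ {i a} → Acc (_≺_ (α i)) a → Acc _<_ (i , a)
      <-acc (acc rs) = acc λ {x} → ∥∥-rec isPropAcc λ (b , b≺a , x≈b) → ≈-acc x≈b (<-acc (rs b≺a))

    segment-⪯ : ∀ {x y} → (∀ z → z < x → z < y) → segment x ⪯ segment y
    segment-⪯ {i , a} {j , c} below =
      ⪯-fromSegments (segment (i , a)) (segment (j , c)) λ (b , b≺a) →
        ∥∥-map (λ (b' , b'≺c , b≈b') → (b' , b'≺c) ,
                  ≋-trans (↓↓-≋ (α i) a (b , b≺a))
                          (≋-trans b≈b' (≋-sym (↓↓-≋ (α j) c (b' , b'≺c)))))
               (below (i , b) ∣ b , b≺a , ≋-refl ∣)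

    <-extensional : ∀ {x y} → (∀ z → (z < x → z < y) × (z < y → z < x)) → x ≈ y
    <-extensional same = segment-⪯ (proj₁ ∘ same) ,≋ segment-⪯ (proj₂ ∘ same)

    open SmallQuotient pe sr _≈_ (λ _ _ → isProp≋) ≋-refl ≋-sym ≋-trans
    open QuotientOrdinal _<_ (λ _ _ → ∥∥-isProp) <-respects <-trans <-wf <-extensional

    sup : Ordinal v
    sup = X/≈ₒ

    sup-upper : ∀ i → α i ⪯ sup
    sup-upper i = toQuotient-⪯ (α i) (i ,_) (λ _ a' a'≺a → ∣ a' , a'≺a , ≋-refl ∣) (λ _ _ → id)

    sup-least : (β : Ordinal v) → (∀ i → α i ⪯ β) → sup ⪯ β
    sup-least β f = fromQuotient-⪯ β g g-respects g-mono g-lift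
      where
      g : X → ⟨ β ⟩
      g (i , a) = proj₁ (f i) a
      g-segment : ∀ x → segment x ≋ β ↓ₒ g x
      g-segment (i , a) = ⪯-↓-≋ (α i) β (f i) a
      g-respects : ∀ {x y} → x ≈ y → g x ≡ g y
      g-respects {x} {y} x≈y =
        ↓-injective β (≋-trans (≋-sym (g-segment x)) (≋-trans x≈y (g-segment y)))
      g-mono : ∀ x y → y < x → g y ≺⟨ β ⟩ g x
      g-mono (j , c) y = ∥∥-rec (≺-prop β _ _) λ (b , b≺c , y≈b) →
        subst (λ t → t ≺⟨ β ⟩ g (j , c)) (sym (g-respects y≈b)) (proj₁ (proj₂ (f j)) c b b≺c)
      g-lift : ∀ x b → b ≺⟨ β ⟩ g x → ∥ Σ[ y ∈ X ] (y < x × g y ≡ b) ∥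
      g-lift (j , c) b b≺gc =
        let (c' , c'≺c , gc'≡b) = proj₂ (proj₂ (f j)) c b b≺gc
        in ∣ (j , c') , ∣ c' , c'≺c , ≋-refl ∣ , gc'≡b ∣

theorem5p13 : FunExt → PropExt → (pt : PropTrunc) → SetReplacement pt →
    (v : Level) → isUnivalent v →
    (I : Set v) (α : I → Ordinal v) →
    Σ[ α̂ ∈ Ordinal v ] (((i : I) → α i ⪯ α̂) ×
      ((β : Ordinal v) → ((i : I) → α i ⪯ β) → α̂ ⪯ β))
theorem5p13 fe pe pt sr v _ I α = sup , sup-upper , sup-least
  where open Supremum fe pt pe sr α
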